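{- Let $n$ be a prime with $n \equiv 1 \pmod 4$. Then $\mathrm{two\_sq}(n) \in \mathrm{fixes}\,(\mathrm{flip})\,(\mathrm{mills}(n))$; that is, $\mathrm{two\_sq}(n)$ is a triple in $\mathrm{mills}(n)$ that is fixed by $\mathrm{flip}$.
   Context: $\mathbb{N}=\{0,1,2,\dots\}$; subtraction on $\mathbb{N}$ is truncated ($a-b=0$ if $a<b$) and associates to the left; $n \operatorname{div} 4$ is the integer quotient. $\mathrm{windmill}(x,y,z) = x^2+4yz$ and $\mathrm{mills}(n)=\{(x,y,z)\in\mathbb{N}^3 : n=\mathrm{windmill}(x,y,z)\}$. $\mathrm{flip}(x,y,z)=(x,z,y)$. The Zagier map on $\mathbb{N}^3$ is: $\mathrm{zagier}(x,y,z)=(x+2z,\,z,\,y-z-x)$ if $x<y-z$; otherwise $(2y-x,\,y,\,x+z-y)$ if $x<2y$; otherwise $(x-2y,\,x+z-y,\,y)$. For a function $f$ and a set $S$, $\mathrm{fixes}\,(f)\,(S)=\{x\in S : f(x)=x\}$. For a predicate $G$ on a set $X$ and a function $B:X\to X$, $\mathrm{WHILE}\;G\;B : X\to X$ is the while-loop with guard $G$ and body $B$: a total function satisfying, for all $x$, $\mathrm{WHILE}\;G\;B\;x = \mathrm{WHILE}\;G\;B\;(B(x))$ if $G(x)$ holds, and $\mathrm{WHILE}\;G\;B\;x = x$ otherwise (its value is otherwise unspecified where the loop does not terminate). $\mathrm{two\_sq}(n) = \mathrm{WHILE}\;(\lambda (x,y,z).\, y\neq z)\;(\mathrm{zagier}\circ\mathrm{flip})\;(1,1,n\operatorname{div}4)$.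 -}

module Defs where

open import Level using (Level; 0ℓ)
open import Data.Bool.Base using (if_then_else_)
open import Data.Nat.Base using (ℕ; _+_; _*_; _∸_; _^_; _/_)
open import Data.Nat.Properties using (_<?_)
open import Data.Product.Base using (∃; _×_; _,_)
open import Function.Base using (_∘_)
open import Relation.Binary.PropositionalEquality.Core using (_≡_; _≢_; refl)
open import Relation.Nullary using (¬_; yes; no; does; contradiction)
open import Relation.Unary using (Pred; _∈_; Decidable)

private
  variable
    a p : Level
    X : Set a

Triple : Set
Triple = ℕ × ℕ × ℕ

windmill : Triple → ℕ
windmill (x , y , z) = x ^ 2 + 4 * y * z

mills : ℕ → Pred Triple 0ℓ
mills n t = n ≡ windmill t

flip : Triple → Triple
flip (x , y , z) = (x , z , y)

zagier : Triple → Triple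
zagier (x , y , z) =
  if does (x <? y ∸ z) then (x + 2 * z , z , y ∸ z ∸ x)
  else if does (x <? 2 * y) then (2 * y ∸ x , y , x + z ∸ y)
  else (x ∸ 2 * y , x + z ∸ y , y)

fixes : (X → X) → Pred X p → Pred X _
fixes f S x = x ∈ S × f x ≡ x

-- While loops over arbitrary guards and bodies need not terminate, so
-- "W is WHILE G B" is a specification of a total function W rather than a
-- definition: W is unconstrained, apart from being constant along the
-- orbit, at states from which the loop diverges.
record IsWhile {X : Set a} (G : Pred X p) (B : X → X) (W : X → X) : Set (a Level.⊔ p) where
  field
    unfold : ∀ x → G x → W x ≡ W (B x)
    exit   : ∀ x → ¬ G x → W x ≡ x

guard : Pred Triple 0ℓ
guard (x , y , z) = y ≢ z

body : Triple → Triple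
body = zagier ∘ flip

-- The argument W stands for WHILE guard body.
two-sq : (Triple → Triple) → ℕ → Triple
two-sq W n = W (1 , 1 , n / 4)

-- IsWhile is satisfiable whenever termination is decidable, in particular
-- (for every guard and body) under excluded middle.
module _ {X : Set a} (G : Pred X p) (B : X → X) where

  data Halts (x : X) : Set (a Level.⊔ p) where
    stop : ¬ G x → Halts x
    step : G x → Halts (B x) → Halts x

  result : ∀ {x} → Halts x → X
  result {x} (stop _) = x
  result (step _ h)   = result h

  result-unique : ∀ {x} (h k : Halts x) → result h ≡ result k
  result-unique (stop _)   (stop _)   = refl
  result-unique (stop ¬g)  (step g _) = contradiction g ¬g
  result-unique (step g _) (stop ¬g)  = contradiction g ¬g
  result-unique (step _ h) (step _ k) = result-unique h k

  while-exists : Decidable Halts → X → ∃ (IsWhile G B)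
  while-exists halts? default = W , record { unfold = unfold ; exit = exit }
    where
    W : X → X
    W x with halts? x
    ... | yes h = result h
    ... | no  _ = default

    unfold : ∀ x → G x → W x ≡ W (B x)
    unfold x g with halts? x | halts? (B x)
    ... | yes h | yes k = result-unique h (step g k)
    ... | yes (stop ¬g)  | no _  = contradiction g ¬g
    ... | yes (step _ h) | no ¬h = contradiction h ¬h
    ... | no ¬h | yes k = contradiction (step g k) ¬h
    ... | no _  | no _  = refl

    exit : ∀ x → ¬ G x → W x ≡ x
    exit x ¬g with halts? x
    ... | yes h = result-unique h (stop ¬g)
    ... | no ¬h = contradiction (stop ¬g) ¬h

{-# OPTIONS --safe #-}

-- On mills n, for n a prime ≡ 1 (mod 4), flip and zagier are involutions, and
-- u = (1 , 1 , n / 4) is the only fixed point of zagier. Reversing the orbit of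
-- u under the body φ = zagier ∘ flip, which is periodic as mills n is finite,
-- gives zagier (φ ^ i u) = φ ^ j u if i + j is a period and
-- flip (φ ^ i u) = φ ^ j u if i + j + 1 is one. An odd period 2 h + 1 thus makes
-- φ ^ h u a fixed point of flip, where the loop exits; for an even period 2 h,
-- φ ^ h u is fixed by zagier, hence equal to u, and h is a smaller period.
module Submission where

open import Defs
open import Data.Fin.Base using (Fin; toℕ; fromℕ<; combine)
open import Data.Fin.Properties using (pigeonhole; combine-injective; fromℕ<-injective)
open import Data.Nat.Base
  using (ℕ; zero; suc; _+_; _*_; _∸_; _^_; _/_; _%_; _≤_; _<_; s≤s; z<s; >-nonZero)
open import Data.Nat.Divisibility using (divides)
open import Data.Nat.DivMod using (m≡m%n+[m/n]*n; m*n%n≡0)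
open import Data.Nat.GeneralisedArithmetic using (fold)
open import Data.Nat.Induction using (Acc; acc; <-wellFounded)
open import Data.Nat.Primality using (Prime; ¬prime[1]; prime⇒nonZero; prime⇒irreducible)
open import Data.Nat.Properties
open import Data.Nat.Solver using (module +-*-Solver)
open import Data.Product.Base using (∃; ∃-syntax; _×_; _,_; proj₁; proj₂)
open import Data.Sum.Base using (_⊎_; inj₁; inj₂)
open import Function.Base using (_∘_)
open import Level using (Level)
open import Relation.Binary.PropositionalEquality
open import Relation.Nullary using (¬_; yes; no; contradiction)
open import Relation.Nullary.Decidable using (dec-true; dec-false)
open import Relation.Unary using (Pred; _∈_)

open +-*-Solver using (solve; con; _:+_; _:*_; _:^_; _:=_)

private
  variable
    a p : Level
    x x′ y z z′ w n : ℕ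

-- Parity and factorisations of primes.

parity : ∀ n → ∃[ h ] (n ≡ h + h ⊎ n ≡ h + suc h)
parity zero = 0 , inj₁ refl
parity (suc n) with parity n
... | h , inj₁ refl = h , inj₂ (sym (+-suc h h))
... | h , inj₂ refl = suc h , inj₁ refl

m+m≡n+n⇒m≡n : ∀ {m n} → m + m ≡ n + n → m ≡ n
m+m≡n+n⇒m≡n {m} {n} eq = *-cancelˡ-≡ m n 2
  (subst₂ (λ i j → m + i ≡ n + j) (sym (+-identityʳ m)) (sym (+-identityʳ n)) eq)

prime-*-trivial : Prime n → ∀ a b → n ≡ a * b → a ≡ 1 ⊎ b ≡ 1
prime-*-trivial {n} pr a b n≡ab
  with prime⇒irreducible pr (divides b (trans n≡ab (*-comm a b)))
... | inj₁ a≡1 = inj₁ a≡1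
... | inj₂ a≡n = inj₂ (*-cancelˡ-≡ b 1 n
  (trans (trans (cong (_* b) (sym a≡n)) (sym n≡ab)) (sym (*-identityʳ n))))
  where instance _ = prime⇒nonZero pr

-- Orbits of products of two involutions

module _ {A : Set a} (P : Pred A p) (g : A → A) (g-closed : ∀ x → P x → P (g x))
         (u : A) (Pu : P u) where

  fold-closed : ∀ i → P (fold u g i)
  fold-closed zero    = Pu
  fold-closed (suc i) = g-closed _ (fold-closed i)

  module _ (g-injective : ∀ x y → P x → P y → g x ≡ g y → x ≡ y) where

    -- Injectivity strips one step from both sides until the earlier index is zero, so the orbit
    -- returns to `u` itself instead of being only eventually periodic.
    fold-cancel : ∀ {i j} → i < j → fold u g i ≡ fold u g j →
                  ∃[ k ] (0 < k × fold u g k ≡ u)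
    fold-cancel {zero}  {suc j} i<j       eq = suc j , z<s , sym eq
    fold-cancel {suc i} {suc j} (s≤s i<j) eq =
      fold-cancel i<j (g-injective _ _ (fold-closed i) (fold-closed j) eq)

    finite-orbit-periodic : ∀ {m} (code : ∀ x → P x → Fin m) →
      (∀ x y (px : P x) (py : P y) → code x px ≡ code y py → x ≡ y) →
      ∃[ k ] (0 < k × fold u g k ≡ u)
    finite-orbit-periodic code code-injective
      -- `≤-refl` makes the index type `Fin (suc m)`: two of the first `m + 1` iterates share a
      -- code.
      with i , j , i<j , eq ← pigeonhole ≤-refl (λ i → code _ (fold-closed (toℕ i)))
      = fold-cancel i<j
          (code-injective _ _ (fold-closed (toℕ i)) (fold-closed (toℕ j)) eq)

involutive⇒injective-on : ∀ {A : Set a} (P : Pred A p) (h : A → A) →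
  (∀ x → P x → h (h x) ≡ x) → ∀ {x y} → P x → P y → h x ≡ h y → x ≡ y
involutive⇒injective-on P h inv px py eq =
  trans (sym (inv _ px)) (trans (cong h eq) (inv _ py))

module _ {A : Set a} (P : Pred A p) (f g : A → A)
         (f-closed : ∀ x → P x → P (f x)) (g-closed : ∀ x → P x → P (g x))
         (f-involutive : ∀ x → P x → f (f x) ≡ x)
         (g-involutive : ∀ x → P x → g (g x) ≡ x) where

  ∘-closed : ∀ x → P x → P (g (f x))
  ∘-closed x px = g-closed (f x) (f-closed x px)

  ∘-injective-on : ∀ x y → P x → P y → g (f x) ≡ g (f y) → x ≡ y
  ∘-injective-on x y px py eq = involutive⇒injective-on P f f-involutive px py
    (involutive⇒injective-on P g g-involutive (f-closed x px) (f-closed y py) eq)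

  module _ (u : A) (Pu : P u) (gu≡u : g u ≡ u) where

    private
      s : ℕ → A
      s = fold u (g ∘ f)

      Ps : ∀ i → P (s i)
      Ps = fold-closed P (g ∘ f) ∘-closed u Pu

      gs[1+i]≡fs[i] : ∀ i → g (s (suc i)) ≡ f (s i)
      gs[1+i]≡fs[i] i = g-involutive (f (s i)) (f-closed (s i) (Ps i))

    -- Mutual induction on `i`. Since `g (s (suc i)) ≡ f (s i)`, the claim for `g` at `suc i` is the
    -- one for `f` at `i`. The claim for `g` at `i` gives `s i ≡ g (s (suc j)) ≡ f (s j)`, and
    -- applying `f` gives the claim for `f` at `i`.
    g-reverses : ∀ {k} → s k ≡ u → ∀ i {j} → i + j ≡ k → g (s i) ≡ s j
    f-reverses : ∀ {k} → s k ≡ u → ∀ i {j} → i + suc j ≡ k → f (s i) ≡ s j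

    g-reverses per zero    refl = trans gu≡u (sym per)
    g-reverses per (suc i) {j} refl =
      trans (gs[1+i]≡fs[i] i) (f-reverses per i (+-suc i j))

    f-reverses per i {j} eq = trans (cong f si≡fsj) (f-involutive (s j) (Ps j))
      where
      si≡fsj : s i ≡ f (s j)
      si≡fsj = trans (sym (g-involutive (s i) (Ps i)))
        (trans (cong g (g-reverses per i eq)) (gs[1+i]≡fs[i] j))

    f-fixes-orbit : (∀ x → P x → g x ≡ x → x ≡ u) →
                    ∀ {k} → 0 < k → s k ≡ u → ∃[ h ] f (s h) ≡ s h
    f-fixes-orbit unique {k} = go (<-wellFounded k)
      where
      go : ∀ {k} → Acc _<_ k → 0 < k → s k ≡ u → ∃[ h ] f (s h) ≡ s h
      go {k} (acc rec) 0<k per with parity k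
      -- `h + suc h` is exactly the index sum of `f-reverses` with both indices equal to `h`.
      ... | h     , inj₂ k≡h+1+h = h , f-reverses per h (sym k≡h+1+h)
      ... | suc h , inj₁ refl    = go (rec (m<m+n (suc h) z<s)) z<s
        (unique (s (suc h)) (Ps (suc h)) (g-reverses per (suc h) refl))
      ... | zero  , inj₁ refl    = contradiction 0<k λ ()

-- The Zagier map

-- The graph of zagier, free of truncated subtraction.
data Zag : Triple → Triple → Set where
  low  : 0 < w → Zag (x , z + (x + w) , z) (2 * z + x , z , w)
  mid  : 0 < x′ → x + x′ ≡ 2 * y → x + z ≡ y + z′ → Zag (x , y , z) (x′ , y , z′)
  high : Zag (2 * y + x , y , z) (x , y + (x + z) , y)

zag-total : ∀ t → ∃ (Zag t)
-- This is the test `x < y ∸ z` in additive form; each outcome yields the differences that become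
-- coordinates of the image.
zag-total (x , y , z) with z + x <? y
... | yes z+x<y with k , refl ← m≤n⇒∃[o]m+o≡n z+x<y =
  _ , subst (λ v → Zag (x , v , z) (2 * z + x , z , suc k)) eq (low z<s)
  where
  eq : z + (x + suc k) ≡ suc (z + x) + k
  eq = trans (sym (+-assoc z x (suc k))) (+-suc (z + x) k)
... | no z+x≮y with x <? 2 * y
...   | yes x<2y with k , eq ← m≤n⇒∃[o]m+o≡n x<2y
                    | z′ , eq′ ← m≤n⇒∃[o]m+o≡n (≮⇒≥ z+x≮y) =
  _ , mid {x′ = suc k} z<s (trans (+-suc x k) eq) (trans (+-comm x z) (sym eq′))
...   | no x≮2y with k , refl ← m≤n⇒∃[o]m+o≡n (≮⇒≥ x≮2y) = _ , high

-- The positive gaps decide the two tests of `zagier`, and every truncated subtraction then has the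
-- form `m + n ∸ m`.
zag-sound : ∀ {t t′} → Zag t t′ → zagier t ≡ t′
zag-sound (low {w} {x} {z} 0<w)
  rewrite m+n∸m≡n z (x + w)
        | dec-true (x <? x + w) (m<m+n x 0<w)
        | m+n∸m≡n x w
        | +-comm x (2 * z) = refl
zag-sound (mid {x′} {x} {y} {z} {z′} 0<x′ x+x′≡2y x+z≡y+z′)
  rewrite dec-false (x <? y ∸ z) (≤⇒≯ (m≤n+o⇒m∸n≤o y z
            (≤-trans (m≤m+n y z′) (≤-reflexive (trans (sym x+z≡y+z′) (+-comm x z))))))
        | sym x+x′≡2y
        | dec-true (x <? x + x′) (m<m+n x 0<x′)
        | m+n∸m≡n x x′
        | x+z≡y+z′
        | m+n∸m≡n y z′ = refl
zag-sound (high {y} {x} {z})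
  rewrite dec-false (2 * y + x <? y ∸ z)
            (≤⇒≯ (≤-trans (m∸n≤m y z) (≤-trans (m≤m+n y (y + 0)) (m≤m+n (2 * y) x))))
        | dec-false (2 * y + x <? 2 * y) (≤⇒≯ (m≤m+n (2 * y) x))
        | m+n∸m≡n (2 * y) x
        -- One `y` is split off so that `∸ y` cancels.
        | solve 3 (λ x y z → con 2 :* y :+ x :+ z := y :+ (y :+ (x :+ z))) refl x y z
        | m+n∸m≡n y (y + (x + z)) = refl

zagier-zag : ∀ t → Zag t (zagier t)
zagier-zag t with t′ , r ← zag-total t = subst (Zag t) (sym (zag-sound r)) r

Positive : Triple → Set
Positive (x , y , z) = 0 < x × 0 < y × 0 < z

-- `low` and `high` are converse to each other and `mid` is its own converse. Positivity of `z` and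
-- of `x` supplies the strict inequalities of the reversed `low` and `mid`.
zag-sym : ∀ {t t′} → Positive t → Zag t t′ → Zag t′ t
zag-sym _             (low _) = high
zag-sym (_ , _ , 0<z) high    = low 0<z
zag-sym (0<x , _)     (mid {x′} {x} {y} {z} {z′} _ x+x′≡2y x+z≡y+z′) =
  mid 0<x (trans (+-comm x′ x) x+x′≡2y) (+-cancelˡ-≡ x _ _ (begin
    x + (x′ + z′)    ≡⟨ +-assoc x x′ z′ ⟨
    x + x′ + z′      ≡⟨ cong (_+ z′) x+x′≡2y ⟩
    2 * y + z′       ≡⟨ solve 2 (λ y z → con 2 :* y :+ z := y :+ (y :+ z)) refl y z′ ⟩
    y + (y + z′)     ≡⟨ cong (y +_) x+z≡y+z′ ⟨
    y + (x + z)      ≡⟨ solve 3 (λ x y z → y :+ (x :+ z) := x :+ (y :+ z)) refl x y z ⟩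
    x + (y + z)      ∎))
  where open ≡-Reasoning

zagier-involutive : ∀ t → Positive t → zagier (zagier t) ≡ t
zagier-involutive t pos = zag-sound (zag-sym pos (zagier-zag t))

-- Adding x * x′ makes the windmill divisible by x + x′ = 2 * y, and the
-- cofactor x + 2 * z is invariant under the middle case of zagier.
windmill-factor : x + x′ ≡ 2 * y →
                  windmill (x , y , z) + x * x′ ≡ (x + x′) * (x + 2 * z)
windmill-factor {x} {x′} {y} {z} x+x′≡2y = begin
  x ^ 2 + 4 * y * z + x * x′
    ≡⟨ solve 4 (λ x x′ y z → x :^ 2 :+ con 4 :* y :* z :+ x :* x′
         := x :^ 2 :+ con 2 :* (con 2 :* y) :* z :+ x :* x′) refl x x′ y z ⟩
  x ^ 2 + 2 * (2 * y) * z + x * x′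
    ≡⟨ cong (λ v → x ^ 2 + 2 * v * z + x * x′) x+x′≡2y ⟨
  x ^ 2 + 2 * (x + x′) * z + x * x′
    ≡⟨ solve 3 (λ x x′ z → x :^ 2 :+ con 2 :* (x :+ x′) :* z :+ x :* x′
         := (x :+ x′) :* (x :+ con 2 :* z)) refl x x′ z ⟩
  (x + x′) * (x + 2 * z) ∎
  where open ≡-Reasoning

zag-windmill : ∀ {t t′} → Zag t t′ → windmill t ≡ windmill t′
zag-windmill (low {w} {x} {z} _) =
  solve 3 (λ x z w → x :^ 2 :+ con 4 :* (z :+ (x :+ w)) :* z
    := (con 2 :* z :+ x) :^ 2 :+ con 4 :* z :* w) refl x z w
zag-windmill (high {y} {x} {z}) =
  solve 3 (λ x y z → (con 2 :* y :+ x) :^ 2 :+ con 4 :* y :* z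
    := x :^ 2 :+ con 4 :* (y :+ (x :+ z)) :* y) refl x y z
zag-windmill (mid {x′} {x} {y} {z} {z′} _ x+x′≡2y x+z≡y+z′) =
  +-cancelʳ-≡ (x * x′) _ _ (begin
    windmill (x , y , z) + x * x′     ≡⟨ windmill-factor {x} {x′} {y} {z} x+x′≡2y ⟩
    (x + x′) * (x + 2 * z)            ≡⟨ cong₂ _*_ (+-comm x x′) cofactor ⟩
    (x′ + x) * (x′ + 2 * z′)          ≡⟨ windmill-factor {x′} {x} {y} {z′} x′+x≡2y ⟨
    windmill (x′ , y , z′) + x′ * x   ≡⟨ cong (windmill (x′ , y , z′) +_) (*-comm x′ x) ⟩
    windmill (x′ , y , z′) + x * x′   ∎)
  where
  open ≡-Reasoning

  x′+x≡2y : x′ + x ≡ 2 * y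
  x′+x≡2y = trans (+-comm x′ x) x+x′≡2y

  cofactor : x + 2 * z ≡ x′ + 2 * z′
  cofactor = +-cancelˡ-≡ x _ _ (begin
    x + (x + 2 * z)    ≡⟨ solve 2 (λ x z → x :+ (x :+ con 2 :* z) := con 2 :* (x :+ z)) refl x z ⟩
    2 * (x + z)        ≡⟨ cong (2 *_) x+z≡y+z′ ⟩
    2 * (y + z′)       ≡⟨ *-distribˡ-+ 2 y z′ ⟩
    2 * y + 2 * z′     ≡⟨ cong (_+ 2 * z′) x+x′≡2y ⟨
    x + x′ + 2 * z′    ≡⟨ +-assoc x x′ (2 * z′) ⟩
    x + (x′ + 2 * z′)  ∎)

zag-fixed⇒x≡y : ∀ {t} → 0 < z → Zag (x , y , z) t → t ≡ (x , y , z) → x ≡ y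
zag-fixed⇒x≡y 0<z (low {w} {x} {z} 0<w) eq =
  contradiction (cong (proj₁ ∘ proj₂) eq)
    (<⇒≢ (m<m+n z (<-≤-trans 0<w (m≤n+m w x))))
zag-fixed⇒x≡y 0<z (high {y} {x} {z}) eq =
  contradiction (cong (proj₁ ∘ proj₂) (sym eq))
    (<⇒≢ (m<m+n y (<-≤-trans 0<z (m≤n+m z x))))
zag-fixed⇒x≡y {y = y} _ (mid _ x+x′≡2y _) refl =
  m+m≡n+n⇒m≡n (trans x+x′≡2y (cong (y +_) (+-identityʳ y)))

-- Invariance and finiteness of `mills n`.

zagier-mills : ∀ t → t ∈ mills n → zagier t ∈ mills n
zagier-mills t t∈ = trans t∈ (zag-windmill (zagier-zag t))

flip-mills : ∀ t → t ∈ mills n → flip t ∈ mills n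
flip-mills (x , y , z) t∈ = trans t∈
  (solve 3 (λ x y z → x :^ 2 :+ con 4 :* y :* z := x :^ 2 :+ con 4 :* z :* y) refl x y z)

body-mills : ∀ t → t ∈ mills n → body t ∈ mills n
body-mills t t∈ = zagier-mills (flip t) (flip-mills t t∈)

-- With all coordinates positive, each is bounded by the windmill value `n`, so the triples embed in
-- a cube of side `suc n`.
code : ∀ t → Positive t → t ∈ mills n → Fin (suc n * (suc n * suc n))
code {n} (x , y , z) (0<x , 0<y , 0<z) t∈ =
  combine (fromℕ< (s≤s x≤n)) (combine (fromℕ< (s≤s y≤n)) (fromℕ< (s≤s z≤n)))
  where
  instance
    _ = >-nonZero 0<x
    _ = >-nonZero 0<y
    _ = >-nonZero 0<z

  open ≤-Reasoning

  4yz≤n : 4 * y * z ≤ n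
  4yz≤n = ≤-trans (m≤n+m (4 * y * z) (x ^ 2)) (≤-reflexive (sym t∈))

  x≤n : x ≤ n
  x≤n = begin
    x                  ≤⟨ m≤m*n x (x ^ 1) ⟩
    x ^ 2              ≤⟨ m≤m+n (x ^ 2) (4 * y * z) ⟩
    windmill (x , y , z) ≡⟨ t∈ ⟨
    n                  ∎
    where instance _ = m^n≢0 x 1

  y≤n : y ≤ n
  y≤n = ≤-trans (m≤n*m y 4) (≤-trans (m≤m*n (4 * y) z) 4yz≤n)

  z≤n : z ≤ n
  z≤n = ≤-trans (m≤n*m z (4 * y)) 4yz≤n
    where instance _ = m*n≢0 4 y

code-injective : ∀ t t′ (pos : Positive t) (t∈ : t ∈ mills n)
                 (pos′ : Positive t′) (t′∈ : t′ ∈ mills n) →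
                 code t pos t∈ ≡ code t′ pos′ t′∈ → t ≡ t′
code-injective _ _ _ _ _ _ eq
  with eqx , eqyz ← combine-injective _ _ _ _ eq
  with eqy , eqz ← combine-injective _ _ _ _ eqyz =
  cong₂ _,_ (fromℕ<-injective _ _ _ _ eqx)
    (cong₂ _,_ (fromℕ<-injective _ _ _ _ eqy) (fromℕ<-injective _ _ _ _ eqz))

-- Windmills of a prime

module _ {n : ℕ} (pr : Prime n) (n%4≡1 : n % 4 ≡ 1) where

  private
    n≡1+4[n/4] : n ≡ 1 + 4 * (n / 4)
    n≡1+4[n/4] = trans (m≡m%n+[m/n]*n n 4) (cong₂ _+_ n%4≡1 (*-comm (n / 4) 4))

    u : Triple
    u = 1 , 1 , n / 4

  u∈mills : u ∈ mills n
  u∈mills = n≡1+4[n/4]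

  x²-not-prime : ∀ x → n ≢ x ^ 2
  -- `x ^ 2` is `x * x ^ 1` by definition.
  x²-not-prime x n≡x² with prime-*-trivial pr x (x ^ 1) n≡x²
  ... | inj₁ refl = ¬prime[1] (subst Prime n≡x² pr)
  ... | inj₂ x¹≡1 with refl ← trans (sym (*-identityʳ x)) x¹≡1 =
    ¬prime[1] (subst Prime n≡x² pr)

  -- `x = 0` would make `n` divisible by 4, and `y = 0` or `z = 0` would make it a square.
  mills-positive : ∀ t → t ∈ mills n → Positive t
  mills-positive (zero , y , z) t∈ = contradiction
    (trans (sym n%4≡1) (trans (cong (_% 4) n≡yz*4) (m*n%n≡0 (y * z) 4))) λ ()
    where
    n≡yz*4 : n ≡ y * z * 4
    n≡yz*4 = trans t∈ (trans (*-assoc 4 y z) (*-comm 4 (y * z)))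
  mills-positive (x@(suc _) , zero , z) t∈ =
    contradiction (trans t∈ (+-identityʳ (x ^ 2))) (x²-not-prime x)
  mills-positive (x@(suc _) , y@(suc _) , zero) t∈ =
    contradiction (trans t∈ (trans (cong (x ^ 2 +_) (*-zeroʳ (4 * y))) (+-identityʳ (x ^ 2))))
                  (x²-not-prime x)
  mills-positive (suc _ , suc _ , suc _) _ = z<s , z<s , z<s

  -- A fixed point has `x = y`, so `n = x * (x + 4 * z)`. The second factor exceeds 1, hence
  -- `x = 1`, and `n = 1 + 4 * z` determines `z`.
  zagier-fixed-unique : ∀ t → t ∈ mills n → zagier t ≡ t → t ≡ u
  zagier-fixed-unique t@(x , y , z) t∈ fixed
    with refl ← zag-fixed⇒x≡y (proj₂ (proj₂ (mills-positive t t∈))) (zagier-zag t) fixed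
    with prime-*-trivial pr x (x + 4 * z) (trans t∈
           (solve 2 (λ x z → x :^ 2 :+ con 4 :* x :* z := x :* (x :+ con 4 :* z)) refl x z))
       | mills-positive t t∈
  ... | inj₁ refl | _ =
    cong (λ v → 1 , 1 , v)
      (*-cancelˡ-≡ z (n / 4) 4 (suc-injective (trans (sym t∈) n≡1+4[n/4])))
  ... | inj₂ x+4z≡1 | 0<x , _ , 0<z = contradiction (sym x+4z≡1)
    (<⇒≢ (<-≤-trans (+-mono-≤-< 0<x 0<z) (+-monoʳ-≤ x (m≤n*m z 4))))

  zagier-u : zagier u ≡ u
  zagier-u = zag-sound {u} {u} (mid z<s refl refl)

  zagier-involutive-mills : ∀ t → t ∈ mills n → zagier (zagier t) ≡ t
  zagier-involutive-mills t t∈ = zagier-involutive t (mills-positive t t∈)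

  body-injective : ∀ t t′ → t ∈ mills n → t′ ∈ mills n → body t ≡ body t′ → t ≡ t′
  body-injective = ∘-injective-on (mills n) flip zagier flip-mills zagier-mills
    (λ _ _ → refl) zagier-involutive-mills

  orbit-periodic : ∃[ k ] (0 < k × fold u body k ≡ u)
  orbit-periodic = finite-orbit-periodic (mills n) body body-mills u u∈mills body-injective
    (λ t t∈ → code t (mills-positive t t∈) t∈)
    (λ t t′ t∈ t′∈ → code-injective t t′ (mills-positive t t∈) t∈ (mills-positive t′ t′∈) t′∈)

  periodic⇒flip-fixed : ∃[ k ] (0 < k × fold u body k ≡ u) →
                        ∃[ h ] flip (fold u body h) ≡ fold u body h
  periodic⇒flip-fixed (k , 0<k , per) =
    f-fixes-orbit (mills n) flip zagier flip-mills zagier-mills (λ _ _ → refl)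
      zagier-involutive-mills u u∈mills zagier-u zagier-fixed-unique 0<k per

-- Exit of the loop.

flip-fixed⇒y≡z : ∀ t → flip t ≡ t → ¬ guard t
flip-fixed⇒y≡z _ refl y≢z = y≢z refl

-- The index `h` only bounds the number of iterations; `j` counts those remaining. Wherever the loop
-- stops, `y = z` holds and the state is still in `mills n`.
while-exits : ∀ {W} → IsWhile guard body W → ∀ t → t ∈ mills n →
              ∃[ h ] flip (fold t body h) ≡ fold t body h → W t ∈ fixes flip (mills n)
while-exits {n} {W} isWhile t t∈ (h , fixed) = go 0 h refl
  where
  open IsWhile isWhile

  s : ℕ → Triple
  s = fold t body

  s∈ : ∀ i → s i ∈ mills n
  s∈ = fold-closed (mills n) body body-mills t t∈

  exited : ∀ i → flip (s i) ≡ s i → W (s i) ∈ fixes flip (mills n)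
  exited i fx = subst (_∈ fixes flip (mills n))
    (sym (exit (s i) (flip-fixed⇒y≡z (s i) fx))) (s∈ i , fx)

  go : ∀ i j → i + j ≡ h → W (s i) ∈ fixes flip (mills n)
  go i zero    refl = exited i (subst (λ k → flip (s k) ≡ s k) (+-identityʳ i) fixed)
  -- The guard may already fail before step `h`.
  go i (suc j) eq with proj₁ (proj₂ (s i)) ≟ proj₂ (proj₂ (s i))
  ... | yes y≡z = exited i (cong₂ (λ v w → proj₁ (s i) , v , w) (sym y≡z) y≡z)
  ... | no  y≢z = subst (_∈ fixes flip (mills n)) (sym (unfold (s i) y≢z))
    (go (suc i) j (trans (sym (+-suc i j)) eq))

theorem7p3 : (W : Triple → Triple) → IsWhile guard body W →
    (n : ℕ) → Prime n → n % 4 ≡ 1 →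
    two-sq W n ∈ fixes flip (mills n)
theorem7p3 W isWhile n pr n%4≡1 =
  while-exits isWhile (1 , 1 , n / 4) (u∈mills pr n%4≡1)
    (periodic⇒flip-fixed pr n%4≡1 (orbit-periodic pr n%4≡1))
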